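{- For $i=1,2$ let $\mathcal L_i=\langle C_i,\models_{M_i}\rangle$ be a matrix logic determined by a $C_i$-matrix $M_i=(\mathbf A_i,D_i)$, where $\mathbf A_i$ has universe $A_i$. Then, for every fibring pair $(\lambda,\mu)$ (i.e. every pair of functions $\lambda:A_1\to A_2$, $\mu:A_2\to A_1$), the fibring by functions $[\mathcal L_1\circledast\mathcal L_2]_{(\lambda,\mu)}=\langle C_\circledast,\models^{\circledast}_{(\lambda,\mu)}\rangle$ (defined via simple fibred valuations) coincides with the matrix logic $\langle C_\circledast,\models_{(M_1\circledast M_2)_{(\lambda,\mu)}}\rangle$; that is, for all $\Gamma\cup\{\varphi\}\subseteq L(C_\circledast)$, $\Gamma\models^{\circledast}_{(\lambda,\mu)}\varphi$ if and only if $\Gamma\models_{(M_1\circledast M_2)_{(\lambda,\mu)}}\varphi$.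
   Context: Fix a countable set $\mathcal V=\{p_1,p_2,\dots\}$ of propositional variables. A signature $C=\{C^k\}_{k\in\mathbb N}$ is a family of pairwise disjoint sets, disjoint from $\mathcal V$ ($C^k$ is the set of $k$-ary connectives); $L(C)$ is the absolutely free algebra over $C$ generated by $\mathcal V$, and its elements are formulas. A $C$-matrix is $M=(\mathbf A,D)$ with $\mathbf A$ a $C$-algebra with universe $A$ and $D\subseteq A$. An $M$-valuation is a homomorphism $v:L(C)\to\mathbf A$ (determined by its restriction to $\mathcal V$). $\Gamma\models_M\varphi$ means: for every $M$-valuation $v$, $v(\Gamma)\subseteq D$ implies $v(\varphi)\in D$. A matrix logic here is a pair $\langle C,\models_M\rangle$. Given $C_i$-matrices $M_i=(\mathbf A_i,D_i)$ with universes $A_i$ ($i=1,2$), put $C_\circledast=C_1\uplus C_2$, $A_\circledast=A_1\uplus A_2$, $D_\circledast=D_1\uplus D_2$ (disjoint unions). A fibring pair is $(\lambda,\mu)$ with $\lambda:A_1\to A_2$, $\mu:A_2\to A_1$. Simple fibred valuations: a simple fibred valuation is a map $v:\mathcal V\to A_\circledast$, extended to $\bar v:L(C_\circledast)\to A_\circledast$ recursively by $\bar v(p)=v(p)$ for $p\in\mathcal V$, and, for $\varphi=c(\psi_1,\dots,\psi_k)$ with $c\in C_i^k$, $\bar v(\varphi)=c^{\mathbf A_i}(\tau_i(\bar v(\psi_1)),\dots,\tau_i(\bar v(\psi_k)))$, where $\tau_1(a)=a$ if $a\in A_1$ and $\tau_1(a)=\mu(a)$ if $a\in A_2$; $\tau_2(a)=a$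 if $a\in A_2$ and $\tau_2(a)=\lambda(a)$ if $a\in A_1$. It satisfies $\varphi$ if $\bar v(\varphi)\in D_\circledast$. $\Gamma\models^{\circledast}_{(\lambda,\mu)}\varphi$ iff every simple fibred valuation satisfying all formulas of $\Gamma$ satisfies $\varphi$. The fibring by functions is $[\mathcal L_1\circledast\mathcal L_2]_{(\lambda,\mu)}=\langle C_\circledast,\models^{\circledast}_{(\lambda,\mu)}\rangle$. Fibred matrix: define $\ast_\lambda:A_\circledast\to A_2$ by $\ast_\lambda(x)=\lambda(x)$ if $x\in A_1$, $\ast_\lambda(x)=x$ if $x\in A_2$; and $\ast_\mu:A_\circledast\to A_1$ by $\ast_\mu(x)=x$ if $x\in A_1$, $\ast_\mu(x)=\mu(x)$ if $x\in A_2$. The $C_\circledast$-matrix $(M_1\circledast M_2)_{(\lambda,\mu)}$ has universe $A_\circledast$, designated set $D_\circledast$, and operations $c(x_1,\dots,x_k)=c^{\mathbf A_1}(\ast_\mu(x_1),\dots,\ast_\mu(x_k))$ for $c\in C_1^k$ and $c(x_1,\dots,x_k)=c^{\mathbf A_2}(\ast_\lambda(x_1),\dots,\ast_\lambda(x_k))$ for $c\in C_2^k$. -}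

module Defs where

open import Level using (Level; _⊔_) renaming (suc to lsuc)
open import Data.Nat.Base using (ℕ)
open import Data.Sum.Base using (_⊎_; inj₁; inj₂; [_,_]′)
open import Data.Vec.Base using (Vec; []; _∷_; map)
open import Function.Base using (id)
open import Relation.Unary using (Pred; _∈_; _⟨⊎⟩_)
open import Relation.Binary.PropositionalEquality using (_≡_)

-- Disjointness of the sets of connectives of different arities, and from the
-- variables, holds by typing.

Signature : (c : Level) → Set (lsuc c)
Signature c = ℕ → Set c

-- Variables p₁, p₂, … are indexed by ℕ.

Var : Set
Var = ℕ

data Formula {c : Level} (C : Signature c) : Set c where
  var : Var → Formula C
  _·_ : {k : ℕ} → C k → Vec (Formula C) k → Formula C

record Algebra {c : Level} (C : Signature c) (a : Level) : Set (c ⊔ lsuc a) where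
  field
    Universe : Set a
    op       : {k : ℕ} → C k → Vec Universe k → Universe

open Algebra public

formulaAlgebra : {c : Level} (C : Signature c) → Algebra C c
formulaAlgebra C = record { Universe = Formula C ; op = _·_ }

record Hom {c a b : Level} {C : Signature c} (A : Algebra C a) (B : Algebra C b)
       : Set (c ⊔ a ⊔ b) where
  field
    fun      : Universe A → Universe B
    preserve : {k : ℕ} (f : C k) (xs : Vec (Universe A) k) →
               fun (op A f xs) ≡ op B f (map fun xs)

open Hom public

record Matrix {c : Level} (C : Signature c) (a d : Level)
       : Set (c ⊔ lsuc a ⊔ lsuc d) where
  field
    algebra    : Algebra C a
    Designated : Pred (Universe algebra) d

open Matrix public

∣_∣ : {c a d : Level} {C : Signature c} → Matrix C a d → Set a
∣ M ∣ = Universe (algebra M)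

Valuation : {c a d : Level} {C : Signature c} → Matrix C a d → Set (c ⊔ a)
Valuation {C = C} M = Hom (formulaAlgebra C) (algebra M)

infix 4 _⊨⟨_⟩_

_⊨⟨_⟩_ : {c a d g : Level} {C : Signature c} →
         Pred (Formula C) g → Matrix C a d → Formula C → Set (c ⊔ a ⊔ d ⊔ g)
Γ ⊨⟨ M ⟩ φ = (v : Valuation M) →
             (∀ ψ → ψ ∈ Γ → fun v ψ ∈ Designated M) → fun v φ ∈ Designated M

infixr 6 _⊎ˢ_

_⊎ˢ_ : {c₁ c₂ : Level} → Signature c₁ → Signature c₂ → Signature (c₁ ⊔ c₂)
(C₁ ⊎ˢ C₂) k = C₁ k ⊎ C₂ k

-- The fibring pair (λ , μ) is written (ƛ , μ), since λ is reserved.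

module Fibring {c₁ c₂ a₁ a₂ d : Level} {C₁ : Signature c₁} {C₂ : Signature c₂}
               (M₁ : Matrix C₁ a₁ d) (M₂ : Matrix C₂ a₂ d)
               (ƛ : ∣ M₁ ∣ → ∣ M₂ ∣) (μ : ∣ M₂ ∣ → ∣ M₁ ∣) where

  A⊛ : Set (a₁ ⊔ a₂)
  A⊛ = ∣ M₁ ∣ ⊎ ∣ M₂ ∣

  D⊛ : Pred A⊛ d
  D⊛ = Designated M₁ ⟨⊎⟩ Designated M₂

  τ₁ : A⊛ → ∣ M₁ ∣
  τ₁ (inj₁ x) = x
  τ₁ (inj₂ y) = μ y

  τ₂ : A⊛ → ∣ M₂ ∣
  τ₂ (inj₁ x) = ƛ x
  τ₂ (inj₂ y) = y

  FibredValuation : Set (a₁ ⊔ a₂)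
  FibredValuation = Var → A⊛

  -- extendArgs v τ is map (λ ψ → τ (extend v ψ)), unfolded so that the
  -- recursion is structural.

  extend     : FibredValuation → Formula (C₁ ⊎ˢ C₂) → A⊛
  extendArgs : {a : Level} {X : Set a} → FibredValuation → (A⊛ → X) →
               {k : ℕ} → Vec (Formula (C₁ ⊎ˢ C₂)) k → Vec X k

  extend v (var p)       = v p
  extend v (inj₁ c · ψs) = inj₁ (op (algebra M₁) c (extendArgs v τ₁ ψs))
  extend v (inj₂ c · ψs) = inj₂ (op (algebra M₂) c (extendArgs v τ₂ ψs))

  extendArgs v τ []       = []
  extendArgs v τ (ψ ∷ ψs) = τ (extend v ψ) ∷ extendArgs v τ ψs

  Satisfies : FibredValuation → Formula (C₁ ⊎ˢ C₂) → Set d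
  Satisfies v φ = extend v φ ∈ D⊛

  infix 4 _⊨⊛_

  _⊨⊛_ : {g : Level} → Pred (Formula (C₁ ⊎ˢ C₂)) g → Formula (C₁ ⊎ˢ C₂) →
         Set (c₁ ⊔ c₂ ⊔ a₁ ⊔ a₂ ⊔ d ⊔ g)
  Γ ⊨⊛ φ = (v : FibredValuation) → (∀ ψ → ψ ∈ Γ → Satisfies v ψ) → Satisfies v φ

  ∗ƛ : A⊛ → ∣ M₂ ∣
  ∗ƛ = [ ƛ , id ]′

  ∗μ : A⊛ → ∣ M₁ ∣
  ∗μ = [ id , μ ]′

  fibredOp : {k : ℕ} → (C₁ ⊎ˢ C₂) k → Vec A⊛ k → A⊛
  fibredOp (inj₁ c) xs = inj₁ (op (algebra M₁) c (map ∗μ xs))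
  fibredOp (inj₂ c) xs = inj₂ (op (algebra M₂) c (map ∗ƛ xs))

  fibredMatrix : Matrix (C₁ ⊎ˢ C₂) (a₁ ⊔ a₂) d
  fibredMatrix = record
    { algebra    = record { Universe = A⊛ ; op = fibredOp }
    ; Designated = D⊛
    }

{-# OPTIONS --safe #-}

-- τ₁ = ∗μ and τ₂ = ∗ƛ pointwise, so extensions of simple fibred valuations are
-- homomorphisms into the fibred matrix; as formulas are absolutely free, every
-- valuation arises in this way from its restriction to the variables.

module Submission where

open import Defs
open import Level using (Level)
open import Data.Nat.Base using (ℕ)
open import Data.Sum.Base using (inj₁; inj₂)
open import Data.Vec.Base using (Vec; []; _∷_; map)
open import Function.Base using (_∘_)
open import Function.Bundles using (_⇔_; mk⇔)
open import Relation.Unary using (Pred)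
open import Relation.Binary.PropositionalEquality
  using (_≡_; _≗_; refl; sym; trans; cong; cong₂; subst)

-- Structural induction: `preserve` determines the value at a compound formula from the values at
-- its arguments. The argument vectors get a mutual recursion of their own, which keeps the descent
-- visibly structural.
Hom-unique : {c b : Level} {C : Signature c} {B : Algebra C b}
  (v w : Hom (formulaAlgebra C) B) → fun v ∘ var ≗ fun w ∘ var → fun v ≗ fun w
Hom-unique {C = C} {B} v w v≗w = unique
  where
  unique     : fun v ≗ fun w
  uniqueArgs : {k : ℕ} (ψs : Vec (Formula C) k) → map (fun v) ψs ≡ map (fun w) ψs

  unique (var p)  = v≗w p
  unique (f · ψs) =
    trans (preserve v f ψs) (trans (cong (op B f) (uniqueArgs ψs)) (sym (preserve w f ψs)))

  uniqueArgs []       = refl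
  uniqueArgs (ψ ∷ ψs) = cong₂ _∷_ (unique ψ) (uniqueArgs ψs)

module _ {c₁ c₂ a₁ a₂ d : Level} {C₁ : Signature c₁} {C₂ : Signature c₂}
         (M₁ : Matrix C₁ a₁ d) (M₂ : Matrix C₂ a₂ d)
         (ƛ : ∣ M₁ ∣ → ∣ M₂ ∣) (μ : ∣ M₂ ∣ → ∣ M₁ ∣) where

  open Fibring M₁ M₂ ƛ μ

  τ₁≗∗μ : τ₁ ≗ ∗μ
  τ₁≗∗μ (inj₁ _) = refl
  τ₁≗∗μ (inj₂ _) = refl

  τ₂≗∗ƛ : τ₂ ≗ ∗ƛ
  τ₂≗∗ƛ (inj₁ _) = refl
  τ₂≗∗ƛ (inj₂ _) = refl

  -- Folds the unfolded recursion of `extendArgs` back into `map`, exchanging `τ` for `σ` entry by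
  -- entry; pointwise equality is enough, so function extensionality is avoided.
  extendArgs≡map : {a : Level} {X : Set a} (v : FibredValuation) {τ σ : A⊛ → X} →
                   τ ≗ σ → {k : ℕ} (ψs : Vec (Formula (C₁ ⊎ˢ C₂)) k) →
                   extendArgs v τ ψs ≡ map σ (map (extend v) ψs)
  extendArgs≡map v τ≗σ []       = refl
  extendArgs≡map v τ≗σ (ψ ∷ ψs) = cong₂ _∷_ (τ≗σ (extend v ψ)) (extendArgs≡map v τ≗σ ψs)

  extendHom : FibredValuation → Valuation fibredMatrix
  extendHom v = record { fun = extend v ; preserve = extend-preserve }
    where
    extend-preserve : {k : ℕ} (f : (C₁ ⊎ˢ C₂) k) (ψs : Vec (Formula (C₁ ⊎ˢ C₂)) k) →
                      extend v (f · ψs) ≡ fibredOp f (map (extend v) ψs)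
    extend-preserve (inj₁ c) ψs = cong (inj₁ ∘ op (algebra M₁) c) (extendArgs≡map v τ₁≗∗μ ψs)
    extend-preserve (inj₂ c) ψs = cong (inj₂ ∘ op (algebra M₂) c) (extendArgs≡map v τ₂≗∗ƛ ψs)

  extend-restrict : (w : Valuation fibredMatrix) → extend (fun w ∘ var) ≗ fun w
  -- On variables `extend` returns the given assignment by computation, hence `refl`.
  extend-restrict w = Hom-unique (extendHom (fun w ∘ var)) w (λ _ → refl)

theorem2p10 : {c₁ c₂ a₁ a₂ d g : Level}
    {C₁ : Signature c₁} {C₂ : Signature c₂}
    (M₁ : Matrix C₁ a₁ d) (M₂ : Matrix C₂ a₂ d)
    (ƛ : ∣ M₁ ∣ → ∣ M₂ ∣) (μ : ∣ M₂ ∣ → ∣ M₁ ∣) →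
    let open Fibring M₁ M₂ ƛ μ in
    (Γ : Pred (Formula (C₁ ⊎ˢ C₂)) g) (φ : Formula (C₁ ⊎ˢ C₂)) →
    (Γ ⊨⊛ φ) ⇔ (Γ ⊨⟨ fibredMatrix ⟩ φ)
theorem2p10 M₁ M₂ ƛ μ Γ φ = mk⇔ ⊛⇒matrix matrix⇒⊛
  where
  open Fibring M₁ M₂ ƛ μ

  ⊛⇒matrix : Γ ⊨⊛ φ → Γ ⊨⟨ fibredMatrix ⟩ φ
  -- The restriction of `w` to variables is the fibred valuation to test; its extension equals `w`
  -- only propositionally, so designation is transported back for the premises and forth for the
  -- conclusion.
  ⊛⇒matrix Γ⊨φ w w⊨Γ = subst D⊛ (w≗ φ)
    (Γ⊨φ (fun w ∘ var) (λ ψ ψ∈Γ → subst D⊛ (sym (w≗ ψ)) (w⊨Γ ψ ψ∈Γ)))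
    where w≗ = extend-restrict M₁ M₂ ƛ μ w

  matrix⇒⊛ : Γ ⊨⟨ fibredMatrix ⟩ φ → Γ ⊨⊛ φ
  -- No transport here: the underlying map of `extendHom` at `v` is `extend v` by definition.
  matrix⇒⊛ Γ⊨φ v = Γ⊨φ (extendHom M₁ M₂ ƛ μ v)
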